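{- Let $0<\varepsilon<1$ and let $r\ge 2$ be an integer. For infinitely many $n$, there exists an $n$-vertex $r$-digraph $G$ with $|E(G)|\ge\left(1-\frac1r-\varepsilon\right)n_{(r)}$ such that every path in $G$ has at most $\frac{r^3}{\varepsilon}$ vertices.
   Context: An $r$-digraph $G$ consists of a finite vertex set $V(G)$ and an edge set $E(G)$ whose elements are ordered lists of $r$ distinct vertices. A path (tight path) in $G$ is a sequence $v_1\ldots v_s$ of distinct vertices of $G$ such that each list of $r$ consecutive vertices $(v_i,\ldots,v_{i+r-1})$, $1\le i\le s-r+1$, is an edge of $G$. $n_{(r)}=n(n-1)\cdots(n-r+1)$ is the falling factorial. -}

module Defs where

open import Data.Fin.Base using (Fin; _↑ʳ_; inject≤)
open import Data.Integer.Base using (+_)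
open import Data.List.Base using (List; length)
open import Data.List.Membership.Propositional using (_∈_)
open import Data.List.Relation.Unary.All using (All)
import Data.List.Relation.Unary.Unique.Propositional as List
open import Data.Nat.Base as ℕ using (ℕ)
import Data.Nat.Properties as ℕ
open import Data.Product.Base using (∃-syntax; _×_; _,_; proj₁; proj₂)
open import Data.Rational.Base
open import Data.Rational.Properties
open import Data.Rational.Solver using (module +-*-Solver)
open import Data.Vec.Base using (Vec; tabulate)
import Data.Vec.Relation.Unary.Unique.Propositional as Vec
open import Function.Definitions using (Injective)
open import Relation.Binary.PropositionalEquality
  using (_≡_; refl; sym; trans; cong; cong₂; subst; module ≡-Reasoning)
open import Relation.Nullary.Decidable using (yes; no)

-- Real numbers, as Cauchy sequences of rationals.  No quotient is taken:
-- two sequences name the same real when each is ≤ℝ the other.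

IsCauchy : (ℕ → ℚ) → Set
IsCauchy x = ∀ e → 0ℚ < e →
  ∃[ N ] (∀ m n → N ℕ.≤ m → N ℕ.≤ n → ∣ x m - x n ∣ ≤ e)

record ℝ : Set where
  constructor mkℝ
  field
    seq    : ℕ → ℚ
    cauchy : IsCauchy seq

open ℝ public

infix 4 _<ℝ_ _≤ℝ_

_<ℝ_ : ℝ → ℝ → Set
x <ℝ y = ∃[ e ] (0ℚ < e × ∃[ N ] (∀ n → N ℕ.≤ n → seq x n + e ≤ seq y n))

_≤ℝ_ : ℝ → ℝ → Set
x ≤ℝ y = ∀ e → 0ℚ < e → ∃[ N ] (∀ n → N ℕ.≤ n → seq x n ≤ seq y n + e)

private
  open +-*-Solver

  ∣p-q∣≡∣q-p∣ : ∀ p q → ∣ p - q ∣ ≡ ∣ q - p ∣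
  ∣p-q∣≡∣q-p∣ p q = trans (sym (∣-p∣≡∣p∣ (p - q)))
    (cong ∣_∣ (solve 2 (λ a b → :- (a :- b) := b :- a) refl p q))

  half : ∀ e → ½ * e + ½ * e ≡ e
  half e = trans (sym (*-distribʳ-+ e ½ ½)) (*-identityˡ e)

  *-pos : ∀ {p q} → 0ℚ < p → 0ℚ < q → 0ℚ < p * q
  *-pos {p} {q} 0<p 0<q =
    positive⁻¹ (p * q) {{pos*pos⇒pos p {{positive 0<p}} q {{positive 0<q}}}}

  const-cauchy : ∀ q → IsCauchy (λ _ → q)
  const-cauchy q e 0<e = 0 , λ _ _ _ _ →
    subst (_≤ e) (sym (cong ∣_∣ (+-inverseʳ q))) (<⇒≤ 0<e)

  +-cauchy : ∀ x y → IsCauchy x → IsCauchy y → IsCauchy (λ n → x n + y n)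
  +-cauchy x y cx cy e 0<e = M ℕ.⊔ N , λ m n l k → begin
    ∣ (x m + y m) - (x n + y n) ∣
      ≡⟨ cong ∣_∣ (solve 4 (λ a b c d → (a :+ b) :- (c :+ d) := (a :- c) :+ (b :- d))
           refl (x m) (y m) (x n) (y n)) ⟩
    ∣ (x m - x n) + (y m - y n) ∣    ≤⟨ ∣p+q∣≤∣p∣+∣q∣ (x m - x n) (y m - y n) ⟩
    ∣ x m - x n ∣ + ∣ y m - y n ∣
      ≤⟨ +-mono-≤
           (proj₂ X m n (ℕ.m⊔n≤o⇒m≤o M N l) (ℕ.m⊔n≤o⇒m≤o M N k))
           (proj₂ Y m n (ℕ.m⊔n≤o⇒n≤o M N l) (ℕ.m⊔n≤o⇒n≤o M N k)) ⟩
    ½ * e + ½ * e                    ≡⟨ half e ⟩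
    e                                ∎
    where
    open ≤-Reasoning
    0<½e = *-pos (positive⁻¹ ½) 0<e
    X = cx (½ * e) 0<½e
    Y = cy (½ * e) 0<½e
    M = proj₁ X
    N = proj₁ Y

  neg-cauchy : ∀ x → IsCauchy x → IsCauchy (λ n → - x n)
  neg-cauchy x cx e 0<e = proj₁ (cx e 0<e) , λ m n l k →
    subst (_≤ e)
      (trans (∣p-q∣≡∣q-p∣ (x m) (x n))
        (cong ∣_∣ (solve 2 (λ a b → b :- a := (:- a) :- (:- b)) refl (x m) (x n))))
      (proj₂ (cx e 0<e) m n l k)

  Bound : (ℕ → ℚ) → Set
  Bound x = ∃[ B ] (0ℚ < B × ∃[ N ] (∀ n → N ℕ.≤ n → ∣ x n ∣ ≤ B))

  bounded : ∀ {x} → IsCauchy x → Bound x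
  bounded {x} cx = ∣ x N ∣ + 1ℚ
    , +-mono-≤-< (0≤∣p∣ (x N)) (positive⁻¹ 1ℚ)
    , N , λ n l → begin
      ∣ x n ∣
        ≡⟨ cong ∣_∣ (solve 2 (λ a b → a := b :+ (a :- b)) refl (x n) (x N)) ⟩
      ∣ x N + (x n - x N) ∣       ≤⟨ ∣p+q∣≤∣p∣+∣q∣ (x N) (x n - x N) ⟩
      ∣ x N ∣ + ∣ x n - x N ∣     ≤⟨ +-monoʳ-≤ ∣ x N ∣ (proj₂ X n N l ℕ.≤-refl) ⟩
      ∣ x N ∣ + 1ℚ                ∎
    where
    open ≤-Reasoning
    X = cx 1ℚ (positive⁻¹ 1ℚ)
    N = proj₁ X

  *-mono-≤ : ∀ {p q s t} → 0ℚ ≤ p → 0ℚ ≤ t → p ≤ q → s ≤ t → p * s ≤ q * t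
  *-mono-≤ {p} {q} {s} {t} 0≤p 0≤t p≤q s≤t = ≤-trans
    (*-monoˡ-≤-nonNeg p {{nonNegative 0≤p}} s≤t)
    (*-monoʳ-≤-nonNeg t {{nonNegative 0≤t}} p≤q)

  weighted-split : ∀ {B C e} → 0ℚ < B → 0ℚ < C → 0ℚ < e →
    ∃[ d ] (0ℚ < d × B * d + d * C ≡ e)
  weighted-split {B} {C} {e} 0<B 0<C 0<e = e * R , *-pos 0<e 0<R , (begin
    B * (e * R) + (e * R) * C   ≡⟨ cong (_+ (e * R) * C) (*-comm B (e * R)) ⟩
    (e * R) * B + (e * R) * C   ≡⟨ *-distribˡ-+ (e * R) B C ⟨
    (e * R) * (B + C)           ≡⟨ *-assoc e R (B + C) ⟩
    e * (R * (B + C))           ≡⟨ cong (e *_) (*-inverseˡ (B + C) {{nz}}) ⟩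
    e * 1ℚ                      ≡⟨ *-identityʳ e ⟩
    e                           ∎)
    where
    open ≡-Reasoning
    0<B+C : 0ℚ < B + C
    0<B+C = +-mono-< 0<B 0<C
    nz : NonZero (B + C)
    nz = >-nonZero 0<B+C
    R : ℚ
    R = (1/ (B + C)) {{nz}}
    0<R : 0ℚ < R
    0<R = positive⁻¹ R {{1/pos⇒pos (B + C) {{positive 0<B+C}}}}

  product-split : ∀ a b c f → a * b - c * f ≡ a * (b - f) + (a - c) * f
  product-split = solve 4
    (λ a b c f → a :* b :- c :* f := a :* (b :- f) :+ (a :- c) :* f) refl

  product-bound : ∀ a b c f {B C d e} → 0ℚ < d → 0ℚ < C →
    ∣ a ∣ ≤ B → ∣ f ∣ ≤ C → ∣ a - c ∣ ≤ d → ∣ b - f ∣ ≤ d →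
    B * d + d * C ≡ e → ∣ a * b - c * f ∣ ≤ e
  product-bound a b c f {B} {C} {d} {e} 0<d 0<C a≤B f≤C a-c≤d b-f≤d B*d+d*C≡e = begin
    ∣ a * b - c * f ∣                          ≡⟨ cong ∣_∣ (product-split a b c f) ⟩
    ∣ a * (b - f) + (a - c) * f ∣              ≤⟨ ∣p+q∣≤∣p∣+∣q∣ (a * (b - f)) ((a - c) * f) ⟩
    ∣ a * (b - f) ∣ + ∣ (a - c) * f ∣          ≡⟨ cong₂ _+_ (∣p*q∣≡∣p∣*∣q∣ a (b - f)) (∣p*q∣≡∣p∣*∣q∣ (a - c) f) ⟩
    ∣ a ∣ * ∣ b - f ∣ + ∣ a - c ∣ * ∣ f ∣      ≤⟨ +-mono-≤
                                                    (*-mono-≤ (0≤∣p∣ a) (<⇒≤ 0<d) a≤B b-f≤d)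
                                                    (*-mono-≤ (0≤∣p∣ (a - c)) (<⇒≤ 0<C) a-c≤d f≤C) ⟩
    B * d + d * C                              ≡⟨ B*d+d*C≡e ⟩
    e                                          ∎
    where open ≤-Reasoning

  *-cauchy : ∀ x y → IsCauchy x → IsCauchy y → IsCauchy (λ n → x n * y n)
  *-cauchy x y cx cy e 0<e = bounds (bounded cx) (bounded cy)
    where
    Goal : Set
    Goal = ∃[ N ] (∀ m n → N ℕ.≤ m → N ℕ.≤ n → ∣ x m * y m - x n * y n ∣ ≤ e)

    tails : ((B , _) : Bound x) ((C , _) : Bound y) →
            ∃[ d ] (0ℚ < d × B * d + d * C ≡ e) → Goal
    tails (B , _ , K , xB) (C , 0<C , L , yC) (d , 0<d , B*d+d*C≡e) =
      (K ℕ.⊔ L) ℕ.⊔ (M ℕ.⊔ N) , λ m n l k →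
      let KL≤m = ℕ.m⊔n≤o⇒m≤o (K ℕ.⊔ L) (M ℕ.⊔ N) l
          KL≤n = ℕ.m⊔n≤o⇒m≤o (K ℕ.⊔ L) (M ℕ.⊔ N) k
          MN≤m = ℕ.m⊔n≤o⇒n≤o (K ℕ.⊔ L) (M ℕ.⊔ N) l
          MN≤n = ℕ.m⊔n≤o⇒n≤o (K ℕ.⊔ L) (M ℕ.⊔ N) k
      in product-bound (x m) (y m) (x n) (y n) 0<d 0<C
           (xB m (ℕ.m⊔n≤o⇒m≤o K L KL≤m))
           (yC n (ℕ.m⊔n≤o⇒n≤o K L KL≤n))
           (proj₂ X m n (ℕ.m⊔n≤o⇒m≤o M N MN≤m) (ℕ.m⊔n≤o⇒m≤o M N MN≤n))
           (proj₂ Y m n (ℕ.m⊔n≤o⇒n≤o M N MN≤m) (ℕ.m⊔n≤o⇒n≤o M N MN≤n))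
           B*d+d*C≡e
      where
      X = cx d 0<d
      Y = cy d 0<d
      M = proj₁ X
      N = proj₁ Y

    bounds : Bound x → Bound y → Goal
    bounds X@(_ , 0<B , _) Y@(_ , 0<C , _) = tails X Y (weighted-split 0<B 0<C 0<e)

-- A real x > 0 may have finitely many terms equal to 0; those terms of the
-- sequence for 1/x are given the irrelevant value 0.

recip : ℚ → ℚ
recip q with q ≟ 0ℚ
... | yes _  = 0ℚ
... | no q≢0 = (1/ q) {{≢-nonZero q≢0}}

recip-inverseˡ : ∀ q → 0ℚ < q → recip q * q ≡ 1ℚ
recip-inverseˡ q 0<q with q ≟ 0ℚ
... | yes refl with () ← <-irrefl refl 0<q
... | no q≢0 = *-inverseˡ q {{≢-nonZero q≢0}}

fromℚ : ℚ → ℝ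
fromℚ q = mkℝ (λ _ → q) (const-cauchy q)

fromℕ : ℕ → ℝ
fromℕ n = fromℚ (+ n / 1)

0ℝ 1ℝ : ℝ
0ℝ = fromℕ 0
1ℝ = fromℕ 1

private
  recip-cauchy : ∀ x → 0ℝ <ℝ x → IsCauchy (λ n → recip (seq x n))
  recip-cauchy (mkℝ x cx) (d , 0<d , K , d≤x) e 0<e = K ℕ.⊔ N , λ m n l k →
    let a = x m
        b = x n
        d≤a = subst (_≤ a) (+-identityˡ d) (d≤x m (ℕ.m⊔n≤o⇒m≤o K N l))
        d≤b = subst (_≤ b) (+-identityˡ d) (d≤x n (ℕ.m⊔n≤o⇒m≤o K N k))
        0<a = <-≤-trans 0<d d≤a
        0<b = <-≤-trans 0<d d≤b
        0<ab = *-pos 0<a 0<b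
        diff : (recip a - recip b) * (a * b) ≡ b - a
        diff = trans
          (solve 4 (λ r s a b → (r :- s) :* (a :* b) := (r :* a) :* b :- (s :* b) :* a)
            refl (recip a) (recip b) a b)
          (cong₂ _-_
            (trans (cong (_* b) (recip-inverseˡ a 0<a)) (*-identityˡ b))
            (trans (cong (_* a) (recip-inverseˡ b 0<b)) (*-identityˡ a)))
    in *-cancelʳ-≤-pos (a * b) {{positive 0<ab}} (begin
      ∣ recip a - recip b ∣ * (a * b)
        ≡⟨ cong (∣ recip a - recip b ∣ *_) (0≤p⇒∣p∣≡p (<⇒≤ 0<ab)) ⟨
      ∣ recip a - recip b ∣ * ∣ a * b ∣   ≡⟨ ∣p*q∣≡∣p∣*∣q∣ (recip a - recip b) (a * b) ⟨
      ∣ (recip a - recip b) * (a * b) ∣   ≡⟨ cong ∣_∣ diff ⟩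
      ∣ b - a ∣                           ≡⟨ ∣p-q∣≡∣q-p∣ b a ⟩
      ∣ a - b ∣                           ≤⟨ proj₂ X m n (ℕ.m⊔n≤o⇒n≤o K N l) (ℕ.m⊔n≤o⇒n≤o K N k) ⟩
      e * (d * d)
        ≤⟨ *-monoˡ-≤-nonNeg e {{nonNegative (<⇒≤ 0<e)}}
             (*-mono-≤ (<⇒≤ 0<d) (<⇒≤ 0<b) d≤a d≤b) ⟩
      e * (a * b)                         ∎)
    where
    open ≤-Reasoning
    X = cx (e * (d * d)) (*-pos 0<e (*-pos 0<d 0<d))
    N = proj₁ X

infixl 6 _+ℝ_ _-ℝ_
infixl 7 _*ℝ_ _/ℝ_[_]
infix  8 -ℝ_

_+ℝ_ : ℝ → ℝ → ℝ
x +ℝ y = mkℝ (λ n → seq x n + seq y n) (+-cauchy (seq x) (seq y) (cauchy x) (cauchy y))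

-ℝ_ : ℝ → ℝ
-ℝ x = mkℝ (λ n → - seq x n) (neg-cauchy (seq x) (cauchy x))

_-ℝ_ : ℝ → ℝ → ℝ
x -ℝ y = x +ℝ (-ℝ y)

_*ℝ_ : ℝ → ℝ → ℝ
x *ℝ y = mkℝ (λ n → seq x n * seq y n) (*-cauchy (seq x) (seq y) (cauchy x) (cauchy y))

_/ℝ_[_] : (x y : ℝ) → 0ℝ <ℝ y → ℝ
x /ℝ y [ 0<y ] = x *ℝ mkℝ (λ n → recip (seq y n)) (recip-cauchy y 0<y)

fromℕ-pos : ∀ {n} → 0 ℕ.< n → 0ℝ <ℝ fromℕ n
fromℕ-pos {n} 0<n =
  + n / 1 , positive⁻¹ (+ n / 1) {{normalize-pos n 1 {{_}} {{ℕ.>-nonZero 0<n}}}}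
  , 0 , λ _ _ → ≤-reflexive (+-identityˡ (+ n / 1))

record Digraph (r n : ℕ) : Set where
  field
    edges          : List (Vec (Fin n) r)
    edges-unique   : List.Unique edges
    edges-distinct : All Vec.Unique edges

  ∣E∣ : ℕ
  ∣E∣ = length edges

open Digraph public

-- The parameter s counts vertices.  The index i is 0-based, so the windows are those
-- starting at i with i + r ≤ s; for s < r there are none.

record Path {r n} (G : Digraph r n) (s : ℕ) : Set where
  field
    vertex          : Fin s → Fin n
    vertex-distinct : Injective _≡_ _≡_ vertex
    window-edge     : ∀ i (i+r≤s : i ℕ.+ r ℕ.≤ s) →
      tabulate (λ (j : Fin r) → vertex (inject≤ (i ↑ʳ j) i+r≤s)) ∈ edges G

-- Let n = km and let a list of r vertices in {0,…,n-1} be an edge when some later entry is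
-- at least m above the first one.  Along a path each vertex that starts a window is followed,
-- within r - 1 steps, by one at least m higher, so a path has at most k(r - 1) vertices.
-- A non-edge with first entry v has its other r - 1 entries among at most
-- min(v + m - 1, n - 1) vertices; by the hockey-stick identity for falling factorials there
-- are at most (1/r + 1/k) n_(r) non-edges.  It remains to take k with 1/ε ≤ k ≤ 5/ε.

module Submission where

open import Defs
open import Data.Product.Base using (∃-syntax; Σ-syntax; _×_; _,_; proj₁; proj₂)
open import Relation.Binary.PropositionalEquality

module Construction where

  open import Data.Bool.Base using (T; true; false)
  open import Data.Fin.Base using (Fin; zero; suc; toℕ; fromℕ<; inject≤; _↑ʳ_; punchIn)
  open import Data.Fin.Properties
    using (punchIn-injective; punchInᵢ≢i; toℕ<n; toℕ-fromℕ<; toℕ-injective; toℕ-inject≤; toℕ-↑ʳ; ¬∀⟶∃¬)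
  open import Data.List.Base as List
    using (List; []; _∷_; _++_; length; filter; tabulate; cartesianProductWith; allFin)
  open import Data.List.Membership.Propositional.Properties using (∈-filter⁻)
  open import Data.List.Properties
    using (filter-++; length-++; length-map; length-filter; length-tabulate; filter-none)
  import Data.List.Relation.Unary.All as ListAll
  import Data.List.Relation.Unary.All.Properties as ListAll
  import Data.List.Relation.Unary.AllPairs as AllPairs
  import Data.List.Relation.Unary.Unique.Propositional as List
  import Data.List.Relation.Unary.Unique.Propositional.Properties as List
  open import Data.Nat.Base
  open import Data.Nat.Combinatorics using (_P_)
  open import Data.Nat.Combinatorics.Base using (_P′_)
  open import Data.Nat.Combinatorics.Specification using (nP′k≡n[n∸1P′k∸1]; P′-rec)
  open import Data.Nat.ListAction using (sum)
  open import Data.Nat.Properties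
  open import Data.Nat.Tactic.RingSolver using (solve-∀)
  open import Data.Sum.Base using (inj₁; inj₂)
  open import Data.Vec.Base as Vec using (Vec; []; _∷_)
  open import Data.Vec.Properties using (∷-injective)
  open import Data.Vec.Relation.Unary.All as All using (All; []; _∷_)
  import Data.Vec.Relation.Unary.All.Properties as All
  open import Data.Vec.Relation.Unary.AllPairs using (_∷_; [])
  import Data.Vec.Relation.Unary.Unique.Propositional as Vec
  import Data.Vec.Relation.Unary.Unique.Propositional.Properties as Vec
  open import Function.Base using (_∘_)
  open import Level using (Level)
  open import Relation.Nullary.Decidable using (yes; no; ¬?)
  open import Relation.Nullary.Negation using (contradiction; ¬_)
  open import Relation.Unary using (Pred; Decidable)

  private
    variable
      a p q : Level
      A B C : Set a

  -- Falling factorials and bounds for their sums.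

  k>n⇒nP′k≡0 : ∀ n k → n < k → n P′ k ≡ 0
  k>n⇒nP′k≡0 n (suc k) (s≤s n≤k) = cong (_* (n P′ k)) (m≤n⇒m∸n≡0 n≤k)

  -- Beyond `n`, `_P_` returns 0 by a test and the product `_P′_` vanishes through truncated
  -- subtraction. The recursions below come from `_P′_`.
  nPk≡nP′k : ∀ n k → n P k ≡ n P′ k
  nPk≡nP′k n k with k ≤ᵇ n in eq
  ... | true  = refl
  ... | false = sym (k>n⇒nP′k≡0 n k (≰⇒> λ k≤n → subst T eq (≤⇒≤ᵇ k≤n)))

  nPk-suc : ∀ n k → suc n P suc k ≡ suc n * (n P k)
  nPk-suc n k = begin-equality
    suc n P suc k      ≡⟨ nPk≡nP′k (suc n) (suc k) ⟩
    suc n P′ suc k     ≡⟨ nP′k≡n[n∸1P′k∸1] (suc n) (suc k) ⟩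
    suc n * (n P′ k)   ≡⟨ cong (suc n *_) (nPk≡nP′k n k) ⟨
    suc n * (n P k)    ∎
    where open ≤-Reasoning

  -- Among the injective lists of length `suc k`, those that use one fixed element have `suc k`
  -- places for it; the others avoid it. For `n < k` both sides are 0.
  nPk-rec : ∀ n k → suc n P suc k ≡ suc k * (n P k) + n P suc k
  nPk-rec n k rewrite nPk≡nP′k n k | nPk≡nP′k n (suc k) | nPk≡nP′k (suc n) (suc k)
    with ≤-<-connex k n
  ... | inj₁ k≤n = P′-rec (s≤s k≤n)
  ... | inj₂ n<k
    rewrite k>n⇒nP′k≡0 n k n<k
          | k>n⇒nP′k≡0 (suc n) (suc k) (s≤s n<k)
          | *-zeroʳ k
          | *-zeroʳ (n ∸ k) = refl

  sum-tabulate-≤ : ∀ {n} b t (f : Fin n → ℕ) → (∀ i → f i ≤ t) →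
    (∀ i → b ≤ toℕ i → f i ≡ 0) → sum (tabulate f) ≤ b * t
  sum-tabulate-≤ {zero}  b       t f f≤t f≡0 = z≤n
  sum-tabulate-≤ {suc n} zero    t f f≤t f≡0
    rewrite f≡0 zero z≤n = sum-tabulate-≤ 0 t (f ∘ suc) (f≤t ∘ suc) (λ i _ → f≡0 (suc i) z≤n)
  sum-tabulate-≤ {suc n} (suc b) t f f≤t f≡0 =
    +-mono-≤ (f≤t zero) (sum-tabulate-≤ b t (f ∘ suc) (f≤t ∘ suc) (λ i b≤i → f≡0 (suc i) (s≤s b≤i)))

  -- The first d terms are bounded by falling factorials, whose sum telescopes by nPk-rec, and
  -- the last b terms by t.
  sum-P-≤ : ∀ q b t d c (f : Fin (d + b) → ℕ) →
    (∀ i → f i ≤ (toℕ i + c) P q) → (∀ i → f i ≤ t) →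
    suc q * sum (tabulate f) + c P suc q ≤ (d + c) P suc q + suc q * (b * t)
  sum-P-≤ q b t zero c f f≤P f≤t = begin
    suc q * sum (tabulate f) + c P suc q   ≡⟨ +-comm (suc q * sum (tabulate f)) _ ⟩
    c P suc q + suc q * sum (tabulate f)
      ≤⟨ +-monoʳ-≤ (c P suc q) (*-monoʳ-≤ (suc q) (sum-tabulate-≤ b t f f≤t (λ i b≤i → contradiction b≤i (<⇒≱ (toℕ<n i))))) ⟩
    c P suc q + suc q * (b * t)            ∎
    where open ≤-Reasoning
  sum-P-≤ q b t (suc d) c f f≤P f≤t = begin
    suc q * (f zero + S) + c P suc q
      ≡⟨ regroup (suc q) (f zero) S (c P suc q) ⟩
    suc q * S + (suc q * f zero + c P suc q)
      ≤⟨ +-monoʳ-≤ (suc q * S) (+-monoˡ-≤ (c P suc q) (*-monoʳ-≤ (suc q) (f≤P zero))) ⟩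
    suc q * S + (suc q * (c P q) + c P suc q)
      ≡⟨ cong (suc q * S +_) (nPk-rec c q) ⟨
    suc q * S + suc c P suc q
      ≤⟨ sum-P-≤ q b t d (suc c) (f ∘ suc)
           (λ i → subst (λ x → f (suc i) ≤ x P q) (sym (+-suc (toℕ i) c)) (f≤P (suc i))) (f≤t ∘ suc) ⟩
    (d + suc c) P suc q + suc q * (b * t)
      ≡⟨ cong (λ x → x P suc q + suc q * (b * t)) (+-suc d c) ⟩
    (suc d + c) P suc q + suc q * (b * t) ∎
    where
    open ≤-Reasoning
    S = sum (tabulate (f ∘ suc))
    regroup : ∀ q x s p → q * (x + s) + p ≡ q * s + (q * x + p)
    regroup = solve-∀

  -- Counting by filtering lists.

  length-filter-map-≤ : {P : Pred B p} {Q : Pred A q} (P? : Decidable P) (Q? : Decidable Q)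
    (f : A → B) → (∀ x → P (f x) → Q x) → ∀ xs →
    length (filter P? (List.map f xs)) ≤ length (filter Q? xs)
  length-filter-map-≤ P? Q? f P⇒Q [] = z≤n
  length-filter-map-≤ P? Q? f P⇒Q (x ∷ xs)
    with P? (f x) | Q? x | length-filter-map-≤ P? Q? f P⇒Q xs
  ... | yes _  | yes _ | ih = s≤s ih
  ... | yes Pfx | no ¬Qx | _ = contradiction (P⇒Q x Pfx) ¬Qx
  ... | no _   | yes _ | ih = m≤n⇒m≤1+n ih
  ... | no _   | no _  | ih = ih

  length-filter-complement : {P : Pred A p} (P? : Decidable P) → ∀ xs →
    length (filter (¬? ∘ P?) xs) + length (filter P? xs) ≡ length xs
  length-filter-complement P? [] = refl
  length-filter-complement P? (x ∷ xs) with P? x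
  ... | yes _ = trans (+-suc _ _) (cong suc (length-filter-complement P? xs))
  ... | no _  = cong suc (length-filter-complement P? xs)

  length-filter-cartesianProductWith : {P : Pred C p} (P? : Decidable P) (f : A → B → C) →
    ∀ {n} (g : Fin n → A) ys →
    length (filter P? (cartesianProductWith f (tabulate g) ys)) ≡
    sum (tabulate λ i → length (filter P? (List.map (f (g i)) ys)))
  length-filter-cartesianProductWith P? f {zero}  g ys = refl
  length-filter-cartesianProductWith P? f {suc n} g ys = begin-equality
    length (filter P? (List.map (f (g zero)) ys ++ rest))
      ≡⟨ cong length (filter-++ P? (List.map (f (g zero)) ys) rest) ⟩
    length (filter P? (List.map (f (g zero)) ys) ++ filter P? rest)
      ≡⟨ length-++ (filter P? (List.map (f (g zero)) ys)) ⟩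
    length (filter P? (List.map (f (g zero)) ys)) + length (filter P? rest)
      ≡⟨ cong (length (filter P? (List.map (f (g zero)) ys)) +_) (length-filter-cartesianProductWith P? f (g ∘ suc) ys) ⟩
    _ ∎
    where
    open ≤-Reasoning
    rest = cartesianProductWith f (tabulate (g ∘ suc)) ys

  length-cartesianProductWith : ∀ (f : A → B → C) xs ys →
    length (cartesianProductWith f xs ys) ≡ length xs * length ys
  length-cartesianProductWith f []       ys = refl
  length-cartesianProductWith f (x ∷ xs) ys = trans (length-++ (List.map (f x) ys))
    (cong₂ _+_ (length-map (f x) ys) (length-cartesianProductWith f xs ys))

  -- Enumeration of the injective lists.

  insertHead : ∀ {r n} → Fin (suc n) → Vec (Fin n) r → Vec (Fin (suc n)) (suc r)
  insertHead v xs = v ∷ Vec.map (punchIn v) xs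

  -- The injective lists of length r, one for each choice of a head v and of an injective
  -- list in the remaining n - 1 elements, which punchIn v enumerates in order.
  arrangements : ∀ r n → List (Vec (Fin n) r)
  arrangements zero    n       = [] ∷ []
  arrangements (suc r) zero    = []
  arrangements (suc r) (suc n) = cartesianProductWith insertHead (allFin (suc n)) (arrangements r n)

  map-punchIn-injective : ∀ {r n} (v : Fin (suc n)) {xs ys : Vec (Fin n) r} →
    Vec.map (punchIn v) xs ≡ Vec.map (punchIn v) ys → xs ≡ ys
  map-punchIn-injective v {[]}     {[]}     _  = refl
  map-punchIn-injective v {x ∷ xs} {y ∷ ys} eq with eq₁ , eq₂ ← ∷-injective eq =
    cong₂ _∷_ (punchIn-injective v x y eq₁) (map-punchIn-injective v eq₂)

  insertHead-injective : ∀ {r n} {v w : Fin (suc n)} {xs ys : Vec (Fin n) r} →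
    insertHead v xs ≡ insertHead w ys → v ≡ w × xs ≡ ys
  insertHead-injective {v = v} eq with refl , eq′ ← ∷-injective eq =
    refl , map-punchIn-injective v eq′

  arrangements-unique : ∀ r n → List.Unique (arrangements r n)
  arrangements-unique zero    n       = ListAll.[] AllPairs.∷ AllPairs.[]
  arrangements-unique (suc r) zero    = AllPairs.[]
  arrangements-unique (suc r) (suc n) =
    List.cartesianProductWith⁺ insertHead insertHead-injective (List.allFin⁺ (suc n)) (arrangements-unique r n)

  insertHead-distinct : ∀ {r n} (v : Fin (suc n)) {xs : Vec (Fin n) r} →
    Vec.Unique xs → Vec.Unique (insertHead v xs)
  insertHead-distinct v {xs} xs! =
    All.map⁺ (All.universal (λ x v≡ → punchInᵢ≢i v x (sym v≡)) xs) ∷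
    Vec.map⁺ (λ {x} {y} → punchIn-injective v x y) xs!

  arrangements-distinct : ∀ r n → ListAll.All Vec.Unique (arrangements r n)
  arrangements-distinct zero    n       = [] ListAll.∷ ListAll.[]
  arrangements-distinct (suc r) zero    = ListAll.[]
  arrangements-distinct (suc r) (suc n) =
    ListAll.cartesianProductWith⁺ (setoid _) (setoid _) insertHead (allFin (suc n)) (arrangements r n)
      (λ {v} _ xs∈ → insertHead-distinct v (ListAll.lookup (arrangements-distinct r n) xs∈))

  length-arrangements : ∀ r n → length (arrangements r n) ≡ n P r
  length-arrangements zero    n       = refl
  length-arrangements (suc r) zero    = refl
  length-arrangements (suc r) (suc n) = begin-equality
    length (arrangements (suc r) (suc n))
      ≡⟨ length-cartesianProductWith insertHead (allFin (suc n)) (arrangements r n) ⟩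
    length (allFin (suc n)) * length (arrangements r n)
      ≡⟨ cong₂ _*_ (length-tabulate {n = suc n} (λ i → i)) (length-arrangements r n) ⟩
    suc n * (n P r)   ≡⟨ nPk-suc n r ⟨
    suc n P suc r     ∎
    where open ≤-Reasoning

  -- Counting the non-edges.

  Below : ∀ {r n} → ℕ → Pred (Vec (Fin n) r) _
  Below b = All (λ x → toℕ x < b)

  below? : ∀ {r n} b → Decidable (Below {r} {n} b)
  below? b = All.all? (λ x → toℕ x <? b)

  -- Values below `v` are fixed by `punchIn v` and lie below `b` because `v ≤ b`; all others are
  -- raised by one.
  punchIn-< : ∀ {n} (v : Fin (suc n)) (x : Fin n) b →
    toℕ v ≤ b → toℕ (punchIn v x) < suc b → toℕ x < b
  punchIn-< zero    x       b       _         (s≤s x<b)  = x<b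
  punchIn-< (suc v) zero    (suc b) _         _          = z<s
  punchIn-< (suc v) (suc x) (suc b) (s≤s v≤b) (s≤s x<1+b) = s≤s (punchIn-< v x b v≤b x<1+b)

  below-punchIn : ∀ {r n} (v : Fin (suc n)) b → toℕ v ≤ b → (xs : Vec (Fin n) r) →
    Below (suc b) (Vec.map (punchIn v) xs) → Below b xs
  below-punchIn v b v≤b xs below =
    All.map (λ {x} → punchIn-< v x b v≤b) (All.map⁻ below)

  -- At most `b` heads are possible, and the remaining entries, renumbered without the head, lie
  -- below `pred b`. This is an inequality because `b` can exceed `n`, as happens for high heads in
  -- `count-stalls`.
  count-below : ∀ r n b → length (filter (below? b) (arrangements r n)) ≤ b P r
  count-below zero    n       b = ≤-refl
  count-below (suc r) zero    b = z≤n
  count-below (suc r) (suc n) b = begin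
    length (filter (below? b) (arrangements (suc r) (suc n)))
      ≡⟨ length-filter-cartesianProductWith (below? b) insertHead (λ i → i) (arrangements r n) ⟩
    sum (tabulate count)          ≤⟨ sum-tabulate-≤ b (pred b P r) count (λ v → bound v b) (λ v → vanishes v) ⟩
    b * (pred b P r)              ≤⟨ step b ⟩
    b P suc r                     ∎
    where
    open ≤-Reasoning
    count : Fin (suc n) → ℕ
    count v = length (filter (below? b) (List.map (insertHead v) (arrangements r n)))

    vanishes : ∀ v {b} → b ≤ toℕ v →
      length (filter (below? b) (List.map (insertHead v) (arrangements r n))) ≡ 0
    vanishes v {b} b≤v = cong length (filter-none (below? b)
      (ListAll.map⁺ (ListAll.universal (λ xs below → <⇒≱ (All.head below) b≤v) (arrangements r n))))

    bound : ∀ v b →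
      length (filter (below? b) (List.map (insertHead v) (arrangements r n))) ≤ pred b P r
    bound v zero    = ≤-trans (≤-reflexive (vanishes v z≤n)) z≤n
    bound v (suc b) = ≤-trans
      (length-filter-map-≤ (below? (suc b)) (below? b) (insertHead v)
        (λ { xs (s≤s v≤b ∷ below) → below-punchIn v b v≤b xs below }) (arrangements r n))
      (count-below r n b)

    step : ∀ b → b * (pred b P r) ≤ b P suc r
    step zero    = z≤n
    step (suc b) = ≤-reflexive (sym (nPk-suc b r))

  -- The non-edges.
  Stalls : ∀ {r n} → ℕ → Pred (Vec (Fin n) (suc r)) _
  Stalls m (v ∷ xs) = Below (toℕ v + m) xs

  stalls? : ∀ {r n} m → Decidable (Stalls {r} {n} m)
  stalls? m (v ∷ xs) = below? (toℕ v + m) xs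

  -- Here the uniformity is `suc r`, the order is `suc L` and `m` is `suc b`. A head `v ≤ d` leaves
  -- at most `v + b` values for the other `r` entries; for the last `b` heads the trivial bound
  -- `L P r` takes over.
  count-stalls : ∀ r b d → let L = d + b in
    suc r * length (filter (stalls? (suc b)) (arrangements (suc r) (suc L))) ≤
    suc L P suc r + suc r * (b * (L P r))
  count-stalls r b d = begin
    suc r * length (filter (stalls? (suc b)) (arrangements (suc r) (suc (d + b))))
      ≡⟨ cong (suc r *_) (length-filter-cartesianProductWith (stalls? (suc b)) insertHead (λ i → i) (arrangements r (d + b))) ⟩
    suc r * sum (tabulate count)
      -- The added term is where the telescoping sum starts: head 0 leaves `b` values.
      ≤⟨ m≤m+n _ (b P suc r) ⟩
    suc r * sum (tabulate count) + b P suc r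
      ≤⟨ sum-P-≤ r b ((d + b) P r) (suc d) b count count≤P count≤all ⟩
    (suc d + b) P suc r + suc r * (b * ((d + b) P r)) ∎
    where
    open ≤-Reasoning
    count : Fin (suc (d + b)) → ℕ
    count v = length (filter (stalls? (suc b)) (List.map (insertHead v) (arrangements r (d + b))))

    count≤P : ∀ v → count v ≤ (toℕ v + b) P r
    count≤P v = ≤-trans
      (length-filter-map-≤ (stalls? (suc b)) (below? (toℕ v + b)) (insertHead v)
        (λ xs below → below-punchIn v (toℕ v + b) (m≤m+n (toℕ v) b) xs
          -- `v + m` is `suc (v + b)`; leaving out the head, itself below `v + m`, costs one value.
          (subst (λ c → Below c (Vec.map (punchIn v) xs)) (+-suc (toℕ v) b) below))
        (arrangements r (d + b)))
      (count-below r (d + b) (toℕ v + b))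

    count≤all : ∀ v → count v ≤ (d + b) P r
    count≤all v = begin
      count v                                                  ≤⟨ length-filter (stalls? (suc b)) (List.map (insertHead v) (arrangements r (d + b))) ⟩
      length (List.map (insertHead v) (arrangements r (d + b)))  ≡⟨ length-map (insertHead v) (arrangements r (d + b)) ⟩
      length (arrangements r (d + b))                           ≡⟨ length-arrangements r (d + b) ⟩
      (d + b) P r                                              ∎

  -- The digraph and its number of edges.

  ascents : ∀ r n → ℕ → Digraph (suc r) n
  ascents r n m = record
    { edges          = filter (¬? ∘ stalls? m) (arrangements (suc r) n)
    ; edges-unique   = List.filter⁺ (¬? ∘ stalls? m) (arrangements-unique (suc r) n)
    ; edges-distinct = ListAll.filter⁺ (¬? ∘ stalls? m) (arrangements-distinct (suc r) n)
    }

  -- With n = (k + 1)(b + 1) this is |E| ≥ (1 - 1/(r + 1) - 1/(k + 1)) (n P (r + 1)), cleared of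
  -- denominators and of subtraction.
  edges-bound : ∀ r b k → let n = suc (k * suc b + b) in
    suc r * (suc k * (n P suc r)) ≤
    suc r * (suc k * ∣E∣ (ascents r n (suc b))) + (suc k + suc r) * (n P suc r)
  edges-bound r b k = begin
    suc r * (suc k * (n P suc r))
      ≡⟨ cong (λ x → suc r * (suc k * x)) total ⟨
    suc r * (suc k * (E + S))
      ≡⟨ regroup (suc r) (suc k) E S ⟩
    suc r * (suc k * E) + suc k * (suc r * S)
      ≤⟨ +-monoʳ-≤ (suc r * (suc k * E)) (*-monoʳ-≤ (suc k) (count-stalls r b (k * suc b))) ⟩
    suc r * (suc k * E) + suc k * (n P suc r + suc r * (b * Q))
      -- Raising `b` to `suc b` makes the factor `suc k * suc b` equal to `n`, and `n * Q` is again
      -- a falling factorial.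
      ≤⟨ +-monoʳ-≤ (suc r * (suc k * E)) (*-monoʳ-≤ (suc k) (+-monoʳ-≤ (n P suc r)
           (*-monoʳ-≤ (suc r) (*-monoˡ-≤ Q (n≤1+n b))))) ⟩
    suc r * (suc k * E) + suc k * (n P suc r + suc r * (suc b * Q))
      ≡⟨ cong (suc r * (suc k * E) +_) (regroup′ (suc r) b k Q (n P suc r)) ⟩
    suc r * (suc k * E) + (suc k * (n P suc r) + suc r * (n * Q))
      ≡⟨ cong (λ x → suc r * (suc k * E) + (suc k * (n P suc r) + suc r * x)) (nPk-suc (k * suc b + b) r) ⟨
    suc r * (suc k * E) + (suc k * (n P suc r) + suc r * (n P suc r))
      ≡⟨ cong (suc r * (suc k * E) +_) (*-distribʳ-+ (n P suc r) (suc k) (suc r)) ⟨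
    suc r * (suc k * E) + (suc k + suc r) * (n P suc r) ∎
    where
    open ≤-Reasoning
    n = suc (k * suc b + b)
    E = ∣E∣ (ascents r n (suc b))
    S = length (filter (stalls? (suc b)) (arrangements (suc r) n))
    Q = (k * suc b + b) P r
    total : E + S ≡ n P suc r
    total = trans (length-filter-complement (stalls? (suc b)) (arrangements (suc r) n))
      (length-arrangements (suc r) n)
    regroup : ∀ r k e s → r * (k * (e + s)) ≡ r * (k * e) + k * (r * s)
    regroup = solve-∀
    regroup′ : ∀ r b k q p → suc k * (p + r * (suc b * q)) ≡ suc k * p + r * (suc (k * suc b + b) * q)
    regroup′ = solve-∀

  -- Ascent along a path.

  module _ {r n m s} (G : Path (ascents r n m) s) where
    open Path G

    -- The window at `i` is an edge, so its `r` later entries are not all low. As the comparison is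
    -- decidable on a finite range, this negation yields a witness.
    ascend : ∀ i → (i+1+r≤s : toℕ i + suc r ≤ s) →
      ∃[ j ] (toℕ i < toℕ j × toℕ j ≤ toℕ i + r × toℕ (vertex i) + m ≤ toℕ (vertex j))
    ascend i i+1+r≤s = later
      (¬∀⟶∃¬ r _ (λ j → toℕ (window (suc j)) <? toℕ (window zero) + m) (no-stall ∘ All.tabulate⁺))
      where
      at : Fin (suc r) → Fin s
      at j = inject≤ (toℕ i ↑ʳ j) i+1+r≤s

      window : Fin (suc r) → Fin n
      window = vertex ∘ at

      toℕ-at : ∀ j → toℕ (at j) ≡ toℕ i + toℕ j
      toℕ-at j = trans (toℕ-inject≤ (toℕ i ↑ʳ j) i+1+r≤s) (toℕ-↑ʳ (toℕ i) j)

      at-zero : at zero ≡ i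
      at-zero = toℕ-injective (trans (toℕ-at zero) (+-identityʳ (toℕ i)))

      no-stall : ¬ Stalls m (Vec.tabulate window)
      no-stall = proj₂ (∈-filter⁻ (¬? ∘ stalls? m) {xs = arrangements (suc r) n}
        (window-edge (toℕ i) i+1+r≤s))

      later : ∃[ j ] ¬ (toℕ (window (suc j)) < toℕ (window zero) + m) →
        ∃[ j ] (toℕ i < toℕ j × toℕ j ≤ toℕ i + r × toℕ (vertex i) + m ≤ toℕ (vertex j))
      later (j , v≮) =
        at (suc j) ,
        <-≤-trans (m<m+n (toℕ i) z<s) (≤-reflexive (sym (toℕ-at (suc j)))) ,
        ≤-trans (≤-reflexive (toℕ-at (suc j))) (+-monoʳ-≤ (toℕ i) (toℕ<n j)) ,
        subst (λ h → toℕ (vertex h) + m ≤ toℕ (window (suc j))) at-zero (≮⇒≥ v≮)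

    -- Iterates `ascend` from position 0. For positive `t`, the last window used starts at or before
    -- `(t - 1) * r`, so `t * r < s` makes it fit inside the path.
    climb : ∀ t → t * r < s →
      ∃[ i ] (toℕ i ≤ t * r × t * m ≤ toℕ (vertex i))
    climb zero    0<s = fromℕ< 0<s , ≤-reflexive (toℕ-fromℕ< 0<s) , z≤n
    climb (suc t) lt with i , i≤ , tm≤ ← climb t (≤-<-trans (m≤n+m (t * r) r) lt)
      with j , i<j , j≤ , up ← ascend i (subst (_≤ s) (sym (+-suc (toℕ i) r)) (≤-trans (s≤s (≤-trans (+-monoˡ-≤ r i≤) (≤-reflexive (+-comm (t * r) r)))) lt)) =
      j , ≤-trans j≤ (≤-trans (+-monoˡ-≤ r i≤) (≤-reflexive (+-comm (t * r) r))) ,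
      ≤-trans (≤-trans (≤-reflexive (+-comm m (t * m))) (+-monoˡ-≤ m tm≤)) up

    -- A longer path could climb `k` times, to a vertex of height at least `k * m`, which is outside
    -- `Fin n`.
    path-bound : ∀ k → n ≤ k * m → s ≤ k * r
    path-bound k n≤km with ≤-<-connex s (k * r)
    ... | inj₁ s≤kr = s≤kr
    ... | inj₂ kr<s with i , _ , km≤v ← climb k kr<s =
      contradiction (≤-trans n≤km km≤v) (<⇒≱ (toℕ<n (vertex i)))

  short-path-digraph : ∀ r k N → ∃[ n ] (N ≤ n × Σ[ G ∈ Digraph (suc r) n ]
    ( suc r * (suc k * (n P suc r)) ≤
      suc r * (suc k * ∣E∣ G) + (suc k + suc r) * (n P suc r)
    × (∀ s → Path G s → s ≤ suc k * r)))
  short-path-digraph r k N =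
    -- Taking `m = suc N` gives `n = suc k * suc N`, which is at least `N`, while the path bound
    -- depends only on `k` and `r`.
    suc (k * suc N + N) , m≤n⇒m≤1+n (m≤n+m N (k * suc N)) ,
    ascents r _ (suc N) , edges-bound r N k ,
    λ s path → path-bound path (suc k)
      (≤-reflexive (cong suc (+-comm (k * suc N) N)))

module Estimates where

  open import Data.Integer.Base as ℤ using (+_; +[1+_]; -[1+_])
  import Data.Integer.Properties as ℤ
  open import Data.Nat.Base as ℕ using (ℕ; zero; suc)
  import Data.Nat.DivMod as ℕ
  import Data.Nat.Properties as ℕ
  open import Data.Nat.Tactic.RingSolver using (solve-∀)
  open import Data.Rational.Base
  open import Data.Rational.Properties
  open import Data.Rational.Solver using (module +-*-Solver)
  open import Data.Rational.Unnormalised.Base as ℚᵘ using (mkℚᵘ; *≡*; *≤*)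
  import Data.Rational.Unnormalised.Properties as ℚᵘ

  -- Natural numbers as rationals, and natural multiples of a rational.

  ι : ℕ → ℚ
  ι n = + n / 1

  -- The fraction `+ n / 1` is normalised by a gcd that does not compute for a variable `n`, so the
  -- laws of `ι` are checked on unnormalised fractions.
  toℚᵘ-ι : ∀ n → toℚᵘ (ι n) ℚᵘ.≃ mkℚᵘ (+ n) 0
  toℚᵘ-ι n = toℚᵘ-fromℚᵘ (mkℚᵘ (+ n) 0)

  ι-+ : ∀ m n → ι (m ℕ.+ n) ≡ ι m + ι n
  ι-+ m n = toℚᵘ-injective (begin-equality
    toℚᵘ (ι (m ℕ.+ n))                   ≃⟨ toℚᵘ-ι (m ℕ.+ n) ⟩
    mkℚᵘ (+ (m ℕ.+ n)) 0                 ≃⟨ *≡* (cong (ℤ._* + 1) (cong₂ ℤ._+_ (sym (ℤ.*-identityʳ (+ m))) (sym (ℤ.*-identityʳ (+ n))))) ⟩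
    mkℚᵘ (+ m) 0 ℚᵘ.+ mkℚᵘ (+ n) 0       ≃⟨ ℚᵘ.+-cong (toℚᵘ-ι m) (toℚᵘ-ι n) ⟨
    toℚᵘ (ι m) ℚᵘ.+ toℚᵘ (ι n)           ≃⟨ toℚᵘ-homo-+ (ι m) (ι n) ⟨
    toℚᵘ (ι m + ι n)                     ∎)
    where open ℚᵘ.≤-Reasoning

  ι-* : ∀ m n → ι (m ℕ.* n) ≡ ι m * ι n
  ι-* m n = toℚᵘ-injective (begin-equality
    toℚᵘ (ι (m ℕ.* n))                   ≃⟨ toℚᵘ-ι (m ℕ.* n) ⟩
    mkℚᵘ (+ (m ℕ.* n)) 0                 ≃⟨ *≡* (cong (ℤ._* + 1) (ℤ.pos-* m n)) ⟩
    mkℚᵘ (+ m) 0 ℚᵘ.* mkℚᵘ (+ n) 0       ≃⟨ ℚᵘ.*-cong (toℚᵘ-ι m) (toℚᵘ-ι n) ⟨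
    toℚᵘ (ι m) ℚᵘ.* toℚᵘ (ι n)           ≃⟨ toℚᵘ-homo-* (ι m) (ι n) ⟨
    toℚᵘ (ι m * ι n)                     ∎)
    where open ℚᵘ.≤-Reasoning

  ι-mono-≤ : ∀ {m n} → m ℕ.≤ n → ι m ≤ ι n
  ι-mono-≤ {m} {n} m≤n = toℚᵘ-cancel-≤ (begin
    toℚᵘ (ι m)     ≃⟨ toℚᵘ-ι m ⟩
    mkℚᵘ (+ m) 0   ≤⟨ *≤* (ℤ.*-monoʳ-≤-nonNeg (+ 1) (ℤ.+≤+ m≤n)) ⟩
    mkℚᵘ (+ n) 0   ≃⟨ toℚᵘ-ι n ⟨
    toℚᵘ (ι n)     ∎)
    where open ℚᵘ.≤-Reasoning

  ι-nonNeg : ∀ n → NonNegative (ι n)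
  ι-nonNeg n = nonNegative (ι-mono-≤ {0} {n} ℕ.z≤n)

  ι-pos : ∀ n → Positive (ι (suc n))
  ι-pos n = normalize-pos (suc n) 1

  -- The premise says that the numerator is non-negative, so that it can be written with `ι`.
  *-↧ : ∀ p → ↥ p ≡ + ℤ.∣ ↥ p ∣ → p * ι (↧ₙ p) ≡ ι ℤ.∣ ↥ p ∣
  *-↧ p@record{} ↥p≡ = toℚᵘ-injective (begin-equality
    toℚᵘ (p * ι (↧ₙ p))                  ≃⟨ toℚᵘ-homo-* p (ι (↧ₙ p)) ⟩
    toℚᵘ p ℚᵘ.* toℚᵘ (ι (↧ₙ p))          ≃⟨ ℚᵘ.*-cong {toℚᵘ p} ℚᵘ.≃-refl (toℚᵘ-ι (↧ₙ p)) ⟩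
    toℚᵘ p ℚᵘ.* mkℚᵘ (↧ p) 0             ≃⟨ *≡* (trans (ℤ.*-identityʳ (↥ p ℤ.* ↧ p)) (cong₂ ℤ._*_ ↥p≡ (sym (ℤ.*-identityʳ (↧ p))))) ⟩
    mkℚᵘ (+ ℤ.∣ ↥ p ∣) 0                 ≃⟨ toℚᵘ-ι ℤ.∣ ↥ p ∣ ⟨
    toℚᵘ (ι ℤ.∣ ↥ p ∣)                   ∎)
    where open ℚᵘ.≤-Reasoning

  -- For q = p/d the multiplier suc k is ⌊2d/p⌋ + 1.
  multiple-between : ∀ q → 0ℚ < q → q ≤ 1ℚ →
    ∃[ k ] (ι 2 ≤ ι (suc k) * q × ι (suc k) * q ≤ ι 3)
  multiple-between (mkℚ (+ zero) d-1 c) 0<q q≤1 with () ← ℤ.drop‿+<+ (drop-*<* 0<q)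
  multiple-between (mkℚ (-[1+ _ ]) d-1 c) 0<q q≤1 with () ← drop-*<* 0<q
  multiple-between q@(mkℚ +[1+ p-1 ] d-1 c) 0<q q≤1 = k ,
    *-cancelʳ-≤-pos (ι d) {{ι-pos d-1}} (begin
      ι 2 * ι d          ≡⟨ ι-* 2 d ⟨
      ι (2 ℕ.* d)        ≤⟨ ι-mono-≤ 2d≤ ⟩
      ι (suc k ℕ.* p)    ≡⟨ clear ⟨
      ι (suc k) * q * ι d  ∎) ,
    *-cancelʳ-≤-pos (ι d) {{ι-pos d-1}} (begin
      ι (suc k) * q * ι d ≡⟨ clear ⟩
      ι (suc k ℕ.* p)    ≤⟨ ι-mono-≤ ≤3d ⟩
      ι (3 ℕ.* d)        ≡⟨ ι-* 3 d ⟩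
      ι 3 * ι d          ∎)
    where
    open ≤-Reasoning
    p = suc p-1
    d = suc d-1
    k = (2 ℕ.* d) ℕ./ p
    -- This is `q ≤ 1`. It bounds by `d` the overshoot of `suc k * p` past `2 * d`, whence the
    -- constant 3.
    p≤d : p ℕ.≤ d
    p≤d = ℕ.≤-trans (ℕ.≤-reflexive (sym (ℕ.*-identityʳ p))) (ℕ.≤-trans (ℤ.drop‿+≤+ (drop-*≤* q≤1)) (ℕ.≤-reflexive (ℕ.*-identityˡ d)))
    2d≡ = ℕ.m≡m%n+[m/n]*n (2 ℕ.* d) p
    2d≤ : 2 ℕ.* d ℕ.≤ suc k ℕ.* p
    2d≤ = ℕ.≤-trans (ℕ.≤-reflexive 2d≡) (ℕ.+-monoˡ-≤ (k ℕ.* p) (ℕ.<⇒≤ (ℕ.m%n<n (2 ℕ.* d) p)))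
    ≤3d : suc k ℕ.* p ℕ.≤ 3 ℕ.* d
    ≤3d = ℕ.+-mono-≤ p≤d (ℕ.≤-trans (ℕ.m≤n+m (k ℕ.* p) ((2 ℕ.* d) ℕ.% p)) (ℕ.≤-reflexive (sym 2d≡)))
    clear : ι (suc k) * q * ι d ≡ ι (suc k ℕ.* p)
    clear = trans (*-assoc (ι (suc k)) q (ι d))
      (trans (cong (ι (suc k) *_) (*-↧ q refl)) (sym (ι-* (suc k) p)))

  -- Rational estimates for the density and the path length.

  p≤∣p∣ : ∀ p → p ≤ ∣ p ∣
  p≤∣p∣ (mkℚ (+ _) _ _)          = ≤-refl
  p≤∣p∣ p@(mkℚ (-[1+ _ ]) _ _) = ≤-trans (<⇒≤ (negative⁻¹ p)) (0≤∣p∣ p)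

  -- Carries bounds on multiples of a fixed term `q` of the sequence of `ε` over to later terms `y`.
  within-half : ∀ {q y} → ∣ y - q ∣ ≤ ½ * q → ½ * q ≤ y × y ≤ (1ℚ + ½) * q
  within-half {q} {y} y≈q = lower , upper
    where
    open ≤-Reasoning
    open +-*-Solver
    lower = begin
      ½ * q           ≡⟨ solve 1 (λ q → con ½ :* q := q :+ :- (con ½ :* q)) refl q ⟩
      q - ½ * q       ≤⟨ +-monoʳ-≤ q (neg-antimono-≤ (≤-trans (p≤∣p∣ (q - y)) (≤-trans (≤-reflexive (d-sym)) y≈q))) ⟩
      q - (q - y)     ≡⟨ solve 2 (λ q y → q :- (q :- y) := y) refl q y ⟩
      y ∎
      where
      d-sym : ∣ q - y ∣ ≡ ∣ y - q ∣
      d-sym = trans (sym (∣-p∣≡∣p∣ (q - y))) (cong ∣_∣ (solve 2 (λ q y → :- (q :- y) := y :- q) refl q y))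
    upper = begin
      y               ≡⟨ solve 2 (λ q y → y := q :+ (y :- q)) refl q y ⟩
      q + (y - q)     ≤⟨ +-monoʳ-≤ q (≤-trans (p≤∣p∣ (y - q)) y≈q) ⟩
      q + ½ * q       ≡⟨ solve 1 (λ q → q :+ con ½ :* q := (con 1ℚ :+ con ½) :* q) refl q ⟩
      (1ℚ + ½) * q    ∎

  -- `x` is the reciprocal of the uniformity and `y` a term of `ε` with `1/K ≤ y`, so the relative
  -- loss `1/R + 1/K` is at most `x + y`. The factor `1ℚ` before `x` matches the termwise form of
  -- the real quotient.
  density-bound : ∀ r k P E {x y} → x * ι (suc r) ≡ 1ℚ → 1ℚ ≤ ι (suc k) * y →
    suc r ℕ.* (suc k ℕ.* P) ℕ.≤ suc r ℕ.* (suc k ℕ.* E) ℕ.+ (suc k ℕ.+ suc r) ℕ.* P →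
    (1ℚ - 1ℚ * x - y) * ι P ≤ ι E
  density-bound r k P E {x} {y} x*r≡1 1≤k*y count =
    *-cancelʳ-≤-pos (R * K) {{pos*pos⇒pos R {{ι-pos r}} K {{ι-pos k}}}} (begin
      (1ℚ - 1ℚ * x - y) * ι P * (R * K)
        ≡⟨ solve 5 (λ x y p r k → (con 1ℚ :- con 1ℚ :* x :- y) :* p :* (r :* k) := r :* (k :* p) :- (x :* r :* (k :* p) :+ k :* y :* (r :* p))) refl x y (ι P) R K ⟩
      R * (K * ι P) - (x * R * (K * ι P) + K * y * (R * ι P))
        ≤⟨ +-monoʳ-≤ (R * (K * ι P)) (neg-antimono-≤ (+-mono-≤ (≤-reflexive (cong (_* (K * ι P)) (sym x*r≡1)))
             (*-monoʳ-≤-nonNeg (R * ι P) {{nonNegative (subst (0ℚ ≤_) (ι-* (suc r) P) (ι-mono-≤ {0} {suc r ℕ.* P} ℕ.z≤n))}} 1≤k*y))) ⟩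
      R * (K * ι P) - (1ℚ * (K * ι P) + 1ℚ * (R * ι P))
        ≡⟨ solve 3 (λ p r k → r :* (k :* p) :- (con 1ℚ :* (k :* p) :+ con 1ℚ :* (r :* p)) := r :* (k :* p) :- (k :+ r) :* p) refl (ι P) R K ⟩
      R * (K * ι P) - (K + R) * ι P
        ≤⟨ +-monoˡ-≤ (- ((K + R) * ι P)) cast ⟩
      R * (K * ι E) + (K + R) * ι P - (K + R) * ι P
        ≡⟨ solve 4 (λ p e r k → r :* (k :* e) :+ (k :+ r) :* p :- (k :+ r) :* p := e :* (r :* k)) refl (ι P) (ι E) R K ⟩
      ι E * (R * K) ∎)
    where
    open ≤-Reasoning
    open +-*-Solver
    R = ι (suc r)
    K = ι (suc k)
    ι-** : ∀ a b c → ι (a ℕ.* (b ℕ.* c)) ≡ ι a * (ι b * ι c)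
    ι-** a b c = trans (ι-* a (b ℕ.* c)) (cong (ι a *_) (ι-* b c))
    cast : R * (K * ι P) ≤ R * (K * ι E) + (K + R) * ι P
    cast = subst₂ _≤_ (ι-** (suc r) (suc k) P)
      (trans (ι-+ (suc r ℕ.* (suc k ℕ.* E)) ((suc k ℕ.+ suc r) ℕ.* P))
        (cong₂ _+_ (ι-** (suc r) (suc k) E)
          (trans (ι-* (suc k ℕ.+ suc r) P) (cong (_* ι P) (ι-+ (suc k) (suc r))))))
      (ι-mono-≤ count)

  -- From `suc k * y ≤ 5` the number of vertices is at most `5 * r / y`, and `5 * r` is at most the
  -- cube of the uniformity `suc r`.
  length-bound : ∀ r k s {y} → 0ℚ < y → ι (suc k) * y ≤ ι 5 → s ℕ.≤ suc k ℕ.* r →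
    ι s ≤ ι (suc r ℕ.^ 3) * recip y
  length-bound r k s {y} 0<y k*y≤5 s≤kr = *-cancelʳ-≤-pos y {{positive 0<y}} (begin
    ι s * y                   ≤⟨ *-monoʳ-≤-nonNeg y {{nonNegative (<⇒≤ 0<y)}} (ι-mono-≤ s≤kr) ⟩
    ι (suc k ℕ.* r) * y       ≡⟨ cong (_* y) (ι-* (suc k) r) ⟩
    ι (suc k) * ι r * y       ≡⟨ solve 3 (λ k r y → k :* r :* y := k :* y :* r) refl (ι (suc k)) (ι r) y ⟩
    ι (suc k) * y * ι r       ≤⟨ *-monoʳ-≤-nonNeg (ι r) {{ι-nonNeg r}} k*y≤5 ⟩
    ι 5 * ι r                 ≡⟨ ι-* 5 r ⟨
    ι (5 ℕ.* r)               ≤⟨ ι-mono-≤ (5r≤ r) ⟩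
    ι (suc r ℕ.^ 3)           ≡⟨ *-identityʳ (ι (suc r ℕ.^ 3)) ⟨
    ι (suc r ℕ.^ 3) * 1ℚ      ≡⟨ cong (ι (suc r ℕ.^ 3) *_) (recip-inverseˡ y 0<y) ⟨
    ι (suc r ℕ.^ 3) * (recip y * y)  ≡⟨ *-assoc (ι (suc r ℕ.^ 3)) (recip y) y ⟨
    ι (suc r ℕ.^ 3) * recip y * y    ∎)
    where
    open ≤-Reasoning
    open +-*-Solver
    5r≤ : ∀ r → 5 ℕ.* r ℕ.≤ suc r ℕ.^ 3
    5r≤ zero = ℕ.z≤n
    -- After this shift of `r` the difference of the two sides has only non-negative coefficients.
    5r≤ (suc r) = ℕ.m+n≤o⇒m≤o (5 ℕ.* suc r) (ℕ.≤-reflexive (excess r))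
      where
      excess : ∀ r → 5 ℕ.* suc r ℕ.+ (r ℕ.* r ℕ.* r ℕ.+ 6 ℕ.* (r ℕ.* r) ℕ.+ 7 ℕ.* r ℕ.+ 3) ≡ suc (suc r) ℕ.* (suc (suc r) ℕ.* (suc (suc r) ℕ.* 1))
      excess = solve-∀

  -- Transfer to the real numbers.

  ≤ℝ-eventually : ∀ x y M → (∀ n → M ℕ.≤ n → seq x n ≤ seq y n) → x ≤ℝ y
  ≤ℝ-eventually x y M x≤y e 0<e = M , λ n M≤n → ≤-trans (x≤y n M≤n)
    (≤-trans (≤-reflexive (sym (+-identityʳ (seq y n)))) (+-monoʳ-≤ (seq y n) (<⇒≤ 0<e)))

  -- `q` is a term of `ε` past three thresholds. The Cauchy tolerance has to be fixed before `q` is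
  -- known; it is `½ * e`, where `e` witnesses `0 < ε` and satisfies `e ≤ q`.
  near-rational : ∀ ε → 0ℝ <ℝ ε → ε <ℝ 1ℝ →
    ∃[ q ] (0ℚ < q × q ≤ 1ℚ × ∃[ M ] (∀ n → M ℕ.≤ n → ∣ seq ε n - q ∣ ≤ ½ * q))
  near-rational ε (e , 0<e , M₁ , e≤ε) (f , 0<f , M₂ , ε≤1) =
    q , <-≤-trans 0<e e≤q , q≤1 , M , λ n M≤n → ≤-trans
      (proj₂ near n M (ℕ.≤-trans M₃≤M M≤n) M₃≤M)
      (*-monoˡ-≤-nonNeg ½ e≤q)
    where
    0<½e : 0ℚ < ½ * e
    0<½e = positive⁻¹ (½ * e) {{pos*pos⇒pos ½ e {{positive 0<e}}}}
    near = cauchy ε (½ * e) 0<½e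
    M₃ = proj₁ near
    M = M₁ ℕ.⊔ M₂ ℕ.⊔ M₃
    M₃≤M : M₃ ℕ.≤ M
    M₃≤M = ℕ.m≤n⊔m (M₁ ℕ.⊔ M₂) M₃
    q = seq ε M
    e≤q : e ≤ q
    e≤q = subst (_≤ q) (+-identityˡ e)
      (e≤ε M (ℕ.≤-trans (ℕ.m≤m⊔n M₁ M₂) (ℕ.m≤m⊔n (M₁ ℕ.⊔ M₂) M₃)))
    q≤1 : q ≤ 1ℚ
    q≤1 = ≤-trans (≤-reflexive (sym (+-identityʳ q))) (≤-trans (+-monoʳ-≤ q (<⇒≤ 0<f))
      (ε≤1 M (ℕ.≤-trans (ℕ.m≤n⊔m M₁ M₂) (ℕ.m≤m⊔n (M₁ ℕ.⊔ M₂) M₃))))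

  -- With `K = suc k`, `2 ≤ K * q ≤ 3` and `q/2 ≤ y ≤ 3q/2` give `1 ≤ K * y ≤ 9/2`; one `k` serves
  -- all terms from `M` on.
  reciprocal-scale : ∀ ε → 0ℝ <ℝ ε → ε <ℝ 1ℝ →
    ∃[ k ] ∃[ M ] (∀ n → M ℕ.≤ n →
      0ℚ < seq ε n × 1ℚ ≤ ι (suc k) * seq ε n × ι (suc k) * seq ε n ≤ ι 5)
  reciprocal-scale ε 0<ε ε<1 with q , 0<q , q≤1 , M , near ← near-rational ε 0<ε ε<1
    with k , 2≤kq , kq≤3 ← multiple-between q 0<q q≤1 = k , M , λ n M≤n →
    let y = seq ε n
        ½q≤y , y≤3/2q = within-half (near n M≤n)
    in <-≤-trans (positive⁻¹ (½ * q) {{pos*pos⇒pos ½ q {{positive 0<q}}}}) ½q≤y ,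
       (begin
         ½ * ι 2        ≤⟨ *-monoˡ-≤-nonNeg ½ 2≤kq ⟩
         ½ * (K k * q)  ≡⟨ swap ½ (K k) q ⟩
         K k * (½ * q)  ≤⟨ *-monoˡ-≤-nonNeg (K k) {{ι-nonNeg (suc k)}} ½q≤y ⟩
         K k * y        ∎) ,
       (begin
         K k * y        ≤⟨ *-monoˡ-≤-nonNeg (K k) {{ι-nonNeg (suc k)}} y≤3/2q ⟩
         K k * ((1ℚ + ½) * q) ≡⟨ swap (1ℚ + ½) (K k) q ⟨
         (1ℚ + ½) * (K k * q) ≤⟨ *-monoˡ-≤-nonNeg (1ℚ + ½) kq≤3 ⟩
         -- `9/2 ≤ 5`, cross-multiplied to `9 ≤ 10`.
         (1ℚ + ½) * ι 3 ≤⟨ *≤* (ℤ.+≤+ (ℕ.m≤m+n 9 1)) ⟩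
         ι 5            ∎)
    where
    open ≤-Reasoning
    open +-*-Solver
    K : ℕ → ℚ
    K k = ι (suc k)
    swap : ∀ a b c → a * (b * c) ≡ b * (a * c)
    swap = solve 3 (λ a b c → a :* (b :* c) := b :* (a :* c)) refl

  -- The real operations act termwise, so each term from `M` on is an instance of `density-bound`.
  density-ℝ : ∀ ε r (0<r : 0ℝ <ℝ fromℕ (suc r)) k p e M →
    (∀ i → M ℕ.≤ i → 1ℚ ≤ ι (suc k) * seq ε i) →
    suc r ℕ.* (suc k ℕ.* p) ℕ.≤ suc r ℕ.* (suc k ℕ.* e) ℕ.+ (suc k ℕ.+ suc r) ℕ.* p →
    (1ℝ -ℝ 1ℝ /ℝ fromℕ (suc r) [ 0<r ] -ℝ ε) *ℝ fromℕ p ≤ℝ fromℕ e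
  density-ℝ ε r 0<r k p e M 1≤kε dense =
    ≤ℝ-eventually ((1ℝ -ℝ 1ℝ /ℝ fromℕ (suc r) [ 0<r ] -ℝ ε) *ℝ fromℕ p) (fromℕ e) M λ i M≤i →
      density-bound r k p e {recip (ι (suc r))} {seq ε i}
        (recip-inverseˡ (ι (suc r)) (positive⁻¹ (ι (suc r)) {{ι-pos r}})) (1≤kε i M≤i) dense

  length-ℝ : ∀ ε (0<ε : 0ℝ <ℝ ε) r k s M →
    (∀ i → M ℕ.≤ i → 0ℚ < seq ε i × ι (suc k) * seq ε i ≤ ι 5) → s ℕ.≤ suc k ℕ.* r →
    fromℕ s ≤ℝ fromℕ (suc r ℕ.^ 3) /ℝ ε [ 0<ε ]
  length-ℝ ε 0<ε r k s M good s≤kr =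
    ≤ℝ-eventually (fromℕ s) (fromℕ (suc r ℕ.^ 3) /ℝ ε [ 0<ε ]) M λ i M≤i →
      length-bound r k s {seq ε i} (proj₁ (good i M≤i)) (proj₂ (good i M≤i)) s≤kr

open import Data.Nat.Base using (ℕ; suc; _≤_; _^_)
open import Data.Nat.Combinatorics using (_P_)
open import Data.Nat.Properties using (<⇒≤)
open Construction using (short-path-digraph)
open Estimates using (reciprocal-scale; density-ℝ; length-ℝ)

lemma31 :
  (ε : ℝ) (0<ε : 0ℝ <ℝ ε) → ε <ℝ 1ℝ →
  (r : ℕ) (2≤r : 2 ≤ r) →
  ∀ (N : ℕ) → ∃[ n ] (N ≤ n ×
    Σ[ G ∈ Digraph r n ]
      ( (1ℝ -ℝ 1ℝ /ℝ fromℕ r [ fromℕ-pos (<⇒≤ 2≤r) ] -ℝ ε) *ℝ fromℕ (n P r) ≤ℝ fromℕ (∣E∣ G)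
      × (∀ (s : ℕ) → Path G s → fromℕ s ≤ℝ fromℕ (r ^ 3) /ℝ ε [ 0<ε ])))
lemma31 ε 0<ε ε<1 (suc r) 2≤r N =
  -- `k` is chosen from `ε` alone, before `N` enters; the uniformity is `suc r`.
  let k , M , good = reciprocal-scale ε 0<ε ε<1
      n , N≤n , G , dense , short = short-path-digraph r k N
  in n , N≤n , G ,
     density-ℝ ε r (fromℕ-pos (<⇒≤ 2≤r)) k (n P suc r) (∣E∣ G) M
       (λ i M≤i → proj₁ (proj₂ (good i M≤i))) dense ,
     λ s path → length-ℝ ε 0<ε r k s M
       (λ i M≤i → proj₁ (good i M≤i) , proj₂ (proj₂ (good i M≤i))) (short s path)
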